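{- For every integer $\ell \ge 3$, the equation \[ n^\ell+(n+1)^\ell + \cdots + (n+k)^\ell=(n+k+1)^\ell+ \cdots + (n+2k)^\ell \] has no solutions in positive integers $k,n$.
   Context: The left-hand side is the sum of the $\ell$-th powers of the $k+1$ consecutive integers $n,\dots,n+k$; the right-hand side is the sum of the $\ell$-th powers of the $k$ consecutive integers $n+k+1,\dots,n+2k$. -}

module Defs where

open import Data.Nat using (ℕ; zero; suc; _+_; _^_)

powSum : ℕ → ℕ → ℕ → ℕ
powSum a zero    ℓ = 0
powSum a (suc m) ℓ = a ^ ℓ + powSum (suc a) m ℓ

{-# OPTIONS --safe #-}
module Submission where

-- With m = n + k and S i = 1^i + … + k^i, reflecting the sums about m turns the equation into
-- m^ℓ = 2 ∑_{i odd} (ℓ C i) m^(ℓ-i) S i.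
-- Size: the terms decay geometrically by the factor (k+1)², so with Q = ℓ k (k+1) (from i = 1) one
-- gets m = Q + r with r ≥ 1 and, from i = 3, 12 ℓ r ≈ P = (ℓ-1)(ℓ-2).  The error is so small that
-- 12 ℓ r = P whenever k (k+1) ≥ ℓ², which is impossible since P ≡ 2 modulo ℓ; for ℓ ≤ 11 the gap
-- between 12 ℓ and P already suffices.
-- 2-adically: if 2^(a+1) is the exact power of 2 in k (k+1), then S i has valuation exactly 2a for
-- odd i ≥ 3 and at least a for i = 1.  If 2^ℓ were larger than ℓ (k+1)², the term with the largest odd
-- index would thus have strictly the smallest valuation in the equation.  So k is exponentially large.

open import Defs
open import Data.Nat
open import Data.Nat.Properties
open import Data.Nat.Combinatorics using (_C_; nCn≡1; nC1≡n; nCk≡nC[n∸k]; k>n⇒nCk≡0; nCk+nC[k+1]≡[n+1]C[k+1])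
open import Data.Nat.Divisibility
open import Data.Nat.Induction using (<-rec)
open import Data.Nat.Tactic.RingSolver using (solve-∀)
open import Data.Empty using (⊥; ⊥-elim)
open import Data.Product using (∃; _,_)
open import Data.Sum using (_⊎_; inj₁; inj₂)
open import Function using (_∘_)
open import Relation.Binary using (tri<; tri≈; tri>)
open import Relation.Binary.PropositionalEquality
  using (_≡_; _≢_; refl; sym; trans; cong; cong₂; subst; subst₂; module ≡-Reasoning)
open import Relation.Nullary using (¬_; yes; no)

-- Finite sums over initial segments.

∑ : ℕ → (ℕ → ℕ) → ℕ
∑ zero    f = 0
∑ (suc n) f = f 0 + ∑ n (f ∘ suc)

∑-cong : ∀ n {f g : ℕ → ℕ} → (∀ i → f i ≡ g i) → ∑ n f ≡ ∑ n g
∑-cong zero    h = refl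
∑-cong (suc n) h = cong₂ _+_ (h 0) (∑-cong n (h ∘ suc))

∑-mono : ∀ n {f g : ℕ → ℕ} → (∀ i → i < n → f i ≤ g i) → ∑ n f ≤ ∑ n g
∑-mono zero    h = z≤n
∑-mono (suc n) h = +-mono-≤ (h 0 z<s) (∑-mono n (λ i i<n → h (suc i) (s<s i<n)))

∑-snoc : ∀ n f → ∑ (suc n) f ≡ ∑ n f + f n
∑-snoc zero    f = +-comm (f 0) 0
∑-snoc (suc n) f = trans (cong (f 0 +_) (∑-snoc n (f ∘ suc))) (sym (+-assoc (f 0) _ _))

interchange : ∀ a b c d → a + b + (c + d) ≡ a + c + (b + d)
interchange = solve-∀

∑-+ : ∀ n f g → ∑ n (λ i → f i + g i) ≡ ∑ n f + ∑ n g
∑-+ zero    f g = refl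
∑-+ (suc n) f g =
  trans (cong (f 0 + g 0 +_) (∑-+ n (f ∘ suc) (g ∘ suc))) (interchange (f 0) (g 0) _ _)

∑-*ˡ : ∀ n c f → ∑ n (λ i → c * f i) ≡ c * ∑ n f
∑-*ˡ zero    c f = sym (*-zeroʳ c)
∑-*ˡ (suc n) c f =
  trans (cong (c * f 0 +_) (∑-*ˡ n c (f ∘ suc))) (sym (*-distribˡ-+ c (f 0) _))

∑-split : ∀ m n f → ∑ (m + n) f ≡ ∑ m f + ∑ n (f ∘ (m +_))
∑-split zero    n f = refl
∑-split (suc m) n f =
  trans (cong (f 0 +_) (∑-split m n (f ∘ suc))) (sym (+-assoc (f 0) _ _))

∑-reverse : ∀ n f → ∑ (suc n) (λ i → f (n ∸ i)) ≡ ∑ (suc n) f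
∑-reverse zero    f = refl
∑-reverse (suc n) f = begin
  f (suc n) + ∑ (suc n) (λ i → f (n ∸ i)) ≡⟨ cong (f (suc n) +_) (∑-reverse n f) ⟩
  f (suc n) + ∑ (suc n) f                 ≡⟨ +-comm (f (suc n)) _ ⟩
  ∑ (suc n) f + f (suc n)                 ≡⟨ ∑-snoc (suc n) f ⟨
  ∑ (suc (suc n)) f                       ∎
  where open ≡-Reasoning

∣-∑ : ∀ {d} n f → (∀ i → i < n → d ∣ f i) → d ∣ ∑ n f
∣-∑ zero    f h = _ ∣0
∣-∑ (suc n) f h = ∣m∣n⇒∣m+n (h 0 z<s) (∣-∑ n (f ∘ suc) (λ i i<n → h (suc i) (s<s i<n)))

-- Congruences of natural numbers.

-- Multiples of d are allowed on both sides to avoid subtraction.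
record Cong (d a b : ℕ) : Set where
  constructor cancelling
  field
    left right : ℕ
    balance    : a + d * left ≡ b + d * right

Cong-refl : ∀ {d} a → Cong d a a
Cong-refl a = cancelling 0 0 refl

Cong-+ : ∀ {d a b a′ b′} → Cong d a b → Cong d a′ b′ → Cong d (a + a′) (b + b′)
Cong-+ {d} {a} {b} {a′} {b′} (cancelling x y p) (cancelling x′ y′ q) = cancelling (x + x′) (y + y′) (begin
  a + a′ + d * (x + x′)       ≡⟨ regroup a a′ d x x′ ⟩
  a + d * x + (a′ + d * x′)   ≡⟨ cong₂ _+_ p q ⟩
  b + d * y + (b′ + d * y′)   ≡⟨ regroup b b′ d y y′ ⟨
  b + b′ + d * (y + y′)       ∎)
  where
  open ≡-Reasoning
  regroup : ∀ a a′ d x x′ → a + a′ + d * (x + x′) ≡ a + d * x + (a′ + d * x′)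
  regroup = solve-∀

Cong-*ˡ : ∀ {d a b} c → Cong d a b → Cong d (c * a) (c * b)
Cong-*ˡ {d} {a} {b} c (cancelling x y p) = cancelling (c * x) (c * y) (begin
  c * a + d * (c * x) ≡⟨ factor c a d x ⟩
  c * (a + d * x)     ≡⟨ cong (c *_) p ⟩
  c * (b + d * y)     ≡⟨ factor c b d y ⟨
  c * b + d * (c * y) ∎)
  where
  open ≡-Reasoning
  factor : ∀ c a d x → c * a + d * (c * x) ≡ c * (a + d * x)
  factor = solve-∀

Cong-trans : ∀ {d a b c} → Cong d a b → Cong d b c → Cong d a c
Cong-trans {d} {a} {b} {c} (cancelling x y p) (cancelling x′ y′ q) = cancelling (x + x′) (y + y′) (begin
  a + d * (x + x′)       ≡⟨ regroup a d x x′ ⟩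
  (a + d * x) + d * x′   ≡⟨ cong (_+ d * x′) p ⟩
  (b + d * y) + d * x′   ≡⟨ swap b (d * y) (d * x′) ⟩
  (b + d * x′) + d * y   ≡⟨ cong (_+ d * y) q ⟩
  (c + d * y′) + d * y   ≡⟨ swap c (d * y′) (d * y) ⟩
  (c + d * y) + d * y′   ≡⟨ regroup c d y y′ ⟨
  c + d * (y + y′)       ∎)
  where
  open ≡-Reasoning
  regroup : ∀ a d x x′ → a + d * (x + x′) ≡ (a + d * x) + d * x′
  regroup = solve-∀
  swap : ∀ a b c → a + b + c ≡ a + c + b
  swap = solve-∀

Cong-∑ : ∀ {d} n f g → (∀ i → i < n → Cong d (f i) (g i)) → Cong d (∑ n f) (∑ n g)
Cong-∑ zero    f g h = Cong-refl 0
Cong-∑ (suc n) f g h =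
  Cong-+ (h 0 z<s) (Cong-∑ n (f ∘ suc) (g ∘ suc) (λ i i<n → h (suc i) (s<s i<n)))

-- Parity and 2-adic valuation.

even⊎odd : ∀ n → (∃ λ u → n ≡ u * 2) ⊎ (∃ λ u → n ≡ suc (u * 2))
even⊎odd zero = inj₁ (0 , refl)
even⊎odd (suc n) with even⊎odd n
... | inj₁ (u , p) = inj₂ (u , cong suc p)
... | inj₂ (u , p) = inj₁ (suc u , cong suc p)

-- The 2-adic valuation of `x` is `t`. Exhibiting the odd cofactor rules out `x ≡ 0` and makes
-- additivity of valuations under products an explicit computation.
record Exact (t x : ℕ) : Set where
  constructor odd-part
  field
    half     : ℕ
    factored : x ≡ 2 ^ t * suc (half * 2)

2^-NonZero : ∀ t → NonZero (2 ^ t)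
2^-NonZero t = m^n≢0 2 t

Exact⇒∣ : ∀ {t x} → Exact t x → 2 ^ t ∣ x
Exact⇒∣ {t} (odd-part u refl) = m∣m*n (suc (u * 2))

2∤odd : ∀ u → 2 ∤ suc (u * 2)
2∤odd u 2∣ with ∣m+n∣m⇒∣n (subst (2 ∣_) (+-comm 1 (u * 2)) 2∣) (n∣m*n u)
... | 2∣1 with ∣1⇒≡1 2∣1
... | ()

Exact⇒∤ : ∀ {t x} → Exact t x → 2 ^ suc t ∤ x
Exact⇒∤ {t} (odd-part u refl) h =
  2∤odd u (*-cancelˡ-∣ (2 ^ t) {{2^-NonZero t}} (subst (_∣ 2 ^ t * suc (u * 2)) (*-comm 2 (2 ^ t)) h))

∣∧∤⇒Exact : ∀ {t x} → 2 ^ t ∣ x → 2 ^ suc t ∤ x → Exact t x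
∣∧∤⇒Exact {t} (divides w refl) h with even⊎odd w
... | inj₁ (u , refl) = ⊥-elim (h (divides u (*-assoc u 2 (2 ^ t))))
... | inj₂ (u , refl) = odd-part u (*-comm (suc (u * 2)) (2 ^ t))

2^t∣2^1+t : ∀ t → 2 ^ t ∣ 2 ^ suc t
2^t∣2^1+t t = n∣m*n 2

Cong-∣ : ∀ {c d a b} → Cong d a b → c ∣ d → c ∣ b → c ∣ a
Cong-∣ {c} {d} {a} {b} (cancelling x y p) c∣d c∣b =
  ∣m+n∣m⇒∣n (subst (c ∣_) (trans (sym p) (+-comm a (d * x)))
              (∣m∣n⇒∣m+n c∣b (∣m⇒∣m*n y c∣d)))
            (∣m⇒∣m*n x c∣d)

Cong-sym : ∀ {d a b} → Cong d a b → Cong d b a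
Cong-sym (cancelling x y p) = cancelling y x (sym p)

-- Valuation `t` is decided by divisibility by 2^t and 2^(t+1) alone, and both are visible modulo
-- any multiple of 2^(t+1).
Exact-Cong : ∀ {t d x z} → Cong d x z → 2 ^ suc t ∣ d → Exact t z → Exact t x
Exact-Cong {t} c 2∣d e =
  ∣∧∤⇒Exact (Cong-∣ c (∣-trans (2^t∣2^1+t t) 2∣d) (Exact⇒∣ e))
            (λ h → Exact⇒∤ e (Cong-∣ (Cong-sym c) 2∣d h))

Exact-* : ∀ {s t x y} → Exact s x → Exact t y → Exact (s + t) (x * y)
Exact-* {s} {t} (odd-part u refl) (odd-part v refl) = odd-part (u * v * 2 + u + v) (begin
  2 ^ s * suc (u * 2) * (2 ^ t * suc (v * 2))  ≡⟨ regroup (2 ^ s) (2 ^ t) u v ⟩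
  2 ^ s * 2 ^ t * suc ((u * v * 2 + u + v) * 2)  ≡⟨ cong (_* suc ((u * v * 2 + u + v) * 2)) (^-distribˡ-+-* 2 s t) ⟨
  2 ^ (s + t) * suc ((u * v * 2 + u + v) * 2)  ∎)
  where
  open ≡-Reasoning
  regroup : ∀ a b u v → a * suc (u * 2) * (b * suc (v * 2)) ≡ a * b * suc ((u * v * 2 + u + v) * 2)
  regroup = solve-∀

Exact-halve : ∀ {t x} → Exact (suc t) (2 * x) → Exact t x
Exact-halve {t} {x} (odd-part u p) = odd-part u (*-cancelˡ-≡ x _ 2 (trans p (*-assoc 2 (2 ^ t) _)))

Exact-odd : ∀ u → Exact 0 (suc (u * 2))
Exact-odd u = odd-part u (sym (+-identityʳ _))

-- 2-adic valuation of the power sums over `j < M`.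

even-^ : ∀ u e → 2 ∣ (u * 2) ^ suc e
even-^ u e = ∣m⇒∣m*n _ (n∣m*n u)

odd-^ : ∀ u e → ∃ λ w → suc (u * 2) ^ e ≡ suc (w * 2)
odd-^ u zero = 0 , refl
odd-^ u (suc e) with odd-^ u e
... | w , p = u * w * 2 + u + w , trans (cong (suc (u * 2) *_) p) (expand u w)
  where
  expand : ∀ u w → suc (u * 2) * suc (w * 2) ≡ suc ((u * w * 2 + u + w) * 2)
  expand = solve-∀

2∣^⇒2∣ : ∀ m e → 2 ∣ m ^ e → 2 ∣ m
2∣^⇒2∣ m e h with even⊎odd m
... | inj₁ (u , refl) = n∣m*n u
... | inj₂ (u , refl) with odd-^ u e
... | w , p = ⊥-elim (2∤odd w (subst (2 ∣_) p h))

-- Among the bases below 2n exactly n are odd, and powers keep parity. The exponent is a successor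
-- because an even base to the power 0 would be odd.
∑-^-parity : ∀ e n → Cong 2 (∑ (n * 2) (_^ suc e)) n
∑-^-parity e zero    = Cong-refl 0
∑-^-parity e (suc n) with odd-^ n (suc e) | even-^ n e | ∑-^-parity e n
... | w , p | divides c q | cancelling x y r = cancelling x (y + c + w) (begin
  ∑ (2 + n * 2) (_^ suc e) + 2 * x
    ≡⟨ cong (_+ 2 * x) (∑-snoc (suc (n * 2)) (_^ suc e)) ⟩
  ∑ (1 + n * 2) (_^ suc e) + suc (n * 2) ^ suc e + 2 * x
    ≡⟨ cong₂ (λ a b → a + b + 2 * x) (∑-snoc (n * 2) (_^ suc e)) p ⟩
  ∑ (n * 2) (_^ suc e) + (n * 2) ^ suc e + suc (w * 2) + 2 * x
    ≡⟨ cong (λ a → ∑ (n * 2) (_^ suc e) + a + suc (w * 2) + 2 * x) q ⟩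
  ∑ (n * 2) (_^ suc e) + c * 2 + suc (w * 2) + 2 * x
    ≡⟨ regroup (∑ (n * 2) (_^ suc e)) c w x ⟩
  (∑ (n * 2) (_^ suc e) + 2 * x) + suc (2 * (c + w))
    ≡⟨ cong (_+ suc (2 * (c + w))) r ⟩
  (n + 2 * y) + suc (2 * (c + w))
    ≡⟨ regroup′ n y c w ⟩
  suc n + 2 * (y + c + w) ∎)
  where
  open ≡-Reasoning
  regroup : ∀ s c w x → s + c * 2 + suc (w * 2) + 2 * x ≡ (s + 2 * x) + suc (2 * (c + w))
  regroup = solve-∀
  regroup′ : ∀ n y c w → (n + 2 * y) + suc (2 * (c + w)) ≡ suc n + 2 * (y + c + w)
  regroup′ = solve-∀

-- Evenness of N is what gives the modulus 2N rather than N: (N + j)² - j² = N² + 2Nj, and N² = 2N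
-- h.
Cong-shift-even-^ : ∀ h j f → let N = h * 2 in Cong (2 * N) ((N + j) ^ (f * 2)) (j ^ (f * 2))
Cong-shift-even-^ h j zero = Cong-refl 1
Cong-shift-even-^ h j (suc f) =
  Cong-trans (cancelling 0 ((N + j) ^ (f * 2) * (h + j)) (square h j ((N + j) ^ (f * 2))))
  (subst₂ (Cong (2 * N)) (*-assoc j j _) (*-assoc j j _) (Cong-*ˡ (j * j) (Cong-shift-even-^ h j f)))
  where
  N = h * 2
  square : ∀ h j P → (h * 2 + j) * ((h * 2 + j) * P) + 2 * (h * 2) * 0
         ≡ j * (j * P) + 2 * (h * 2) * (P * (h + j))
  square = solve-∀

-- Induction on `a` by doubling the range. By periodicity the second half of the range repeats the
-- first modulo 2N, so the sum up to 2N is twice the sum up to N modulo a multiple of 2^(a+2), and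
-- the valuation rises by exactly one. At `a = 0` the sum is congruent modulo 2 to the odd number
-- `suc (q * 2)`.
Exact-∑-even-^ : ∀ a q f → Exact a (∑ (2 ^ suc a * suc (q * 2)) (_^ (suc f * 2)))
Exact-∑-even-^ zero q f =
  Exact-Cong (subst (λ n → Cong 2 (∑ n (_^ (suc f * 2))) (suc (q * 2))) (*-comm (suc (q * 2)) 2)
               (∑-^-parity (suc (f * 2)) (suc (q * 2))))
             ∣-refl (Exact-odd q)
Exact-∑-even-^ (suc a) q f with Exact-∑-even-^ a q f
... | odd-part u p = Exact-Cong
  (subst₂ (Cong (2 * N)) (trans (sym (∑-split N N _)) (cong (λ n → ∑ n (_^ (suc f * 2))) N+N)) refl step)
  (subst (2 ^ suc (suc a) ∣_) (*-assoc 2 (2 ^ suc a) (suc (q * 2))) (m∣m*n (suc (q * 2))))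
  (odd-part u doubled)
  where
  open ≡-Reasoning
  Q = suc (q * 2)
  N = 2 ^ suc a * Q
  E = ∑ N (_^ (suc f * 2))
  N≡ : N ≡ 2 ^ a * Q * 2
  N≡ = reassoc (2 ^ a) Q
    where
    reassoc : ∀ x Q → 2 * x * Q ≡ x * Q * 2
    reassoc = solve-∀
  N+N : N + N ≡ 2 ^ suc (suc a) * Q
  N+N = reassoc (2 ^ suc a) Q
    where
    reassoc : ∀ x Q → x * Q + x * Q ≡ 2 * x * Q
    reassoc = solve-∀
  step : Cong (2 * N) (E + ∑ N (λ j → (N + j) ^ (suc f * 2))) (E + E)
  step = Cong-+ (Cong-refl E) (Cong-∑ N _ _ λ j _ →
    subst (λ n → Cong (2 * n) ((n + j) ^ (suc f * 2)) (j ^ (suc f * 2))) (sym N≡)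
      (Cong-shift-even-^ (2 ^ a * Q) j (suc f)))
  doubled : E + E ≡ 2 ^ suc a * suc (u * 2)
  doubled = begin
    E + E                             ≡⟨ cong₂ _+_ p p ⟩
    2 ^ a * suc (u * 2) + 2 ^ a * suc (u * 2) ≡⟨ reassoc (2 ^ a) (suc (u * 2)) ⟩
    2 ^ suc a * suc (u * 2) ∎
    where
    reassoc : ∀ x Q → x * Q + x * Q ≡ 2 * x * Q
    reassoc = solve-∀

-- The binomial expansion of p^i = (M - j)^i modulo M², for odd i.
Cong-pair-odd-^ : ∀ j p f → let M = p + j in
  Cong (M * M) (p ^ suc (f * 2) + j ^ suc (f * 2)) (suc (f * 2) * M * j ^ (f * 2))
Cong-pair-odd-^ j p zero = cancelling 0 0 (base j p)
  where
  base : ∀ j p → p * 1 + j * 1 + (p + j) * (p + j) * 0 ≡ (1 + 0) * (p + j) * 1 + (p + j) * (p + j) * 0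
  base = solve-∀
-- The step from i to i + 2 rests on p² + 2jM = M² + j². Adding `2 * j * M * P` to both sides avoids
-- the negative term, and it is cancelled at the end.
Cong-pair-odd-^ j p (suc f) with Cong-pair-odd-^ j p f
... | cancelling x y r = cancelling x′ y′ (+-cancelʳ-≡ (2 * j * M * P) _ _ (begin
  p * (p * P) + j * (j * (j * J)) + M * M * x′ + 2 * j * M * P
    ≡⟨ left j p P J F x y ⟩
  M * M * P + j * j * (P + j * J + M * M * x) + 2 * j * M * (F * M * J + M * M * y)
    ≡⟨ cong₂ (λ a b → M * M * P + j * j * a + 2 * j * M * b) r (sym r) ⟩
  M * M * P + j * j * (F * M * J + M * M * y) + 2 * j * M * (P + j * J + M * M * x)
    ≡⟨ right j p P J F x y ⟩
  (2 + F) * M * (j * (j * J)) + M * M * y′ + 2 * j * M * P ∎))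
  where
  open ≡-Reasoning
  M = p + j
  P = p ^ suc (f * 2)
  J = j ^ (f * 2)
  F = suc (f * 2)
  x′ = j * j * x + 2 * j * F * J + 2 * j * M * y
  y′ = P + j * j * y + 2 * j * M * x
  left : ∀ j p P J F x y → let M = p + j in
    p * (p * P) + j * (j * (j * J)) + M * M * (j * j * x + 2 * j * F * J + 2 * j * M * y) + 2 * j * M * P
    ≡ M * M * P + j * j * (P + j * J + M * M * x) + 2 * j * M * (F * M * J + M * M * y)
  left = solve-∀
  right : ∀ j p P J F x y → let M = p + j in
    M * M * P + j * j * (F * M * J + M * M * y) + 2 * j * M * (P + j * J + M * M * x)
    ≡ (2 + F) * M * (j * (j * J)) + M * M * (P + j * j * y + 2 * j * M * x) + 2 * j * M * P
  right = solve-∀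

-- Pair `j` with `M ∸ j` for j from 0 to M. The additional summands at j = M are M^i and, on the
-- right, i M times M^(i-1), all multiples of M² since i is at least 3.
Cong-∑-odd-^ : ∀ M f →
  Cong (M * M) (2 * ∑ M (_^ suc (suc f * 2))) (suc (suc f * 2) * M * ∑ M (_^ (suc f * 2)))
Cong-∑-odd-^ M f = halves paired
  where
  open ≡-Reasoning
  i = suc (suc f * 2)
  J = M ^ (f * 2)
  A = ∑ M (_^ i)
  E = ∑ M (_^ (suc f * 2))
  regroup : ∀ A M J x → 2 * A + M * M * (2 * (M * J) + x)
    ≡ (A + M * (M * (M * J))) + (A + M * (M * (M * J))) + M * M * x
  regroup = solve-∀
  regroup′ : ∀ i M E J y → i * M * (E + M * (M * J)) + M * M * y ≡ i * M * E + M * M * (i * J * M + y)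
  regroup′ = solve-∀
  paired : Cong (M * M) (∑ (suc M) (λ j → (M ∸ j) ^ i + j ^ i)) (∑ (suc M) (λ j → i * M * j ^ (suc f * 2)))
  paired = Cong-∑ (suc M) _ _ λ j j≤M →
    subst (λ n → Cong (n * n) ((M ∸ j) ^ i + j ^ i) (i * n * j ^ (suc f * 2)))
      (m∸n+n≡m (≤-pred j≤M)) (Cong-pair-odd-^ j (M ∸ j) (suc f))
  halves : Cong (M * M) (∑ (suc M) (λ j → (M ∸ j) ^ i + j ^ i)) (∑ (suc M) (λ j → i * M * j ^ (suc f * 2))) →
    Cong (M * M) (2 * A) (i * M * E)
  halves (cancelling x y p) = cancelling (2 * (M * J) + x) (i * J * M + y) (begin
    2 * A + M * M * (2 * (M * J) + x)
      ≡⟨ regroup A M J x ⟩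
    (A + M * (M * (M * J))) + (A + M * (M * (M * J))) + M * M * x
      ≡⟨ cong (λ s → s + s + M * M * x) (∑-snoc M (_^ i)) ⟨
    ∑ (suc M) (_^ i) + ∑ (suc M) (_^ i) + M * M * x
      ≡⟨ cong (λ s → s + ∑ (suc M) (_^ i) + M * M * x) (∑-reverse M (_^ i)) ⟨
    ∑ (suc M) (λ j → (M ∸ j) ^ i) + ∑ (suc M) (_^ i) + M * M * x
      ≡⟨ cong (_+ M * M * x) (∑-+ (suc M) (λ j → (M ∸ j) ^ i) (_^ i)) ⟨
    ∑ (suc M) (λ j → (M ∸ j) ^ i + j ^ i) + M * M * x
      ≡⟨ p ⟩
    ∑ (suc M) (λ j → i * M * j ^ (suc f * 2)) + M * M * y
      ≡⟨ cong (_+ M * M * y) (∑-*ˡ (suc M) (i * M) (_^ (suc f * 2))) ⟩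
    i * M * ∑ (suc M) (_^ (suc f * 2)) + M * M * y
      ≡⟨ cong (λ s → i * M * s + M * M * y) (∑-snoc M (_^ (suc f * 2))) ⟩
    i * M * (E + M * (M * J)) + M * M * y
      ≡⟨ regroup′ i M E J y ⟩
    i * M * E + M * M * (i * J * M + y) ∎)

-- In the previous congruence i is odd, M contributes a + 1 and the even power sum contributes a,
-- while M² contains 2^(2a+2). So twice the sum has valuation 2a + 1.
Exact-∑-odd-^ : ∀ a q f → Exact (a + a) (∑ (2 ^ suc a * suc (q * 2)) (_^ suc (suc f * 2)))
Exact-∑-odd-^ a q f = Exact-halve (Exact-Cong (Cong-∑-odd-^ M f) 2∣MM
  (Exact-* {suc a} {a} (Exact-* {0} {suc a} (Exact-odd (suc f)) (odd-part q refl)) (Exact-∑-even-^ a q f)))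
  where
  M = 2 ^ suc a * suc (q * 2)
  2∣MM : 2 ^ suc (suc (a + a)) ∣ M * M
  2∣MM = subst (_∣ M * M) (trans (sym (^-distribˡ-+-* 2 (suc a) (suc a))) (cong (2 ^_) (cong suc (+-suc a a))))
    (*-pres-∣ (m∣m*n {2 ^ suc a} _) (m∣m*n {2 ^ suc a} _))

-- Binomial expansion as a functional of the powers of X.

-- The expansion of (m + X)^ℓ with each X^i replaced by χ i.
umbral : ℕ → ℕ → (ℕ → ℕ) → ℕ
umbral zero    m χ = χ 0
umbral (suc ℓ) m χ = m * umbral ℓ m χ + umbral ℓ m (χ ∘ suc)

umbral-cong : ∀ ℓ m {χ ψ : ℕ → ℕ} → (∀ i → χ i ≡ ψ i) → umbral ℓ m χ ≡ umbral ℓ m ψ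
umbral-cong zero    m h = h 0
umbral-cong (suc ℓ) m h = cong₂ (λ a b → m * a + b) (umbral-cong ℓ m h) (umbral-cong ℓ m (h ∘ suc))

umbral-+ : ∀ ℓ m χ ψ → umbral ℓ m (λ i → χ i + ψ i) ≡ umbral ℓ m χ + umbral ℓ m ψ
umbral-+ zero    m χ ψ = refl
umbral-+ (suc ℓ) m χ ψ =
  trans (cong₂ (λ a b → m * a + b) (umbral-+ ℓ m χ ψ) (umbral-+ ℓ m (χ ∘ suc) (ψ ∘ suc)))
        (regroup m (umbral ℓ m χ) (umbral ℓ m ψ) _ _)
  where
  regroup : ∀ m a b c d → m * (a + b) + (c + d) ≡ m * a + c + (m * b + d)
  regroup = solve-∀

umbral-*ˡ : ∀ ℓ m c χ → umbral ℓ m (λ i → c * χ i) ≡ c * umbral ℓ m χ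
umbral-*ˡ zero    m c χ = refl
umbral-*ˡ (suc ℓ) m c χ =
  trans (cong₂ (λ a b → m * a + b) (umbral-*ˡ ℓ m c χ) (umbral-*ˡ ℓ m c (χ ∘ suc)))
        (regroup m c (umbral ℓ m χ) _)
  where
  regroup : ∀ m c a b → m * (c * a) + c * b ≡ c * (m * a + b)
  regroup = solve-∀

nC0≡1 : ∀ n → n C 0 ≡ 1
nC0≡1 n = trans (nCk≡nC[n∸k] {k = 0} {n = n} z≤n) (nCn≡1 n)

umbral-expand : ∀ ℓ m χ → umbral ℓ m χ ≡ ∑ (suc ℓ) (λ i → (ℓ C i) * m ^ (ℓ ∸ i) * χ i)
umbral-expand zero    m χ = sym (trans (+-identityʳ _) (+-identityʳ _))
umbral-expand (suc ℓ) m χ = begin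
  m * umbral ℓ m χ + umbral ℓ m (χ ∘ suc)
    ≡⟨ cong₂ (λ a b → m * a + b) (umbral-expand ℓ m χ) (umbral-expand ℓ m (χ ∘ suc)) ⟩
  m * ∑ (suc ℓ) t + ∑ (suc ℓ) shifted
    ≡⟨ cong (λ s → m * s + ∑ (suc ℓ) shifted) extend ⟩
  m * ∑ (suc (suc ℓ)) t + ∑ (suc ℓ) shifted
    ≡⟨ cong (_+ ∑ (suc ℓ) shifted) (∑-*ˡ (suc (suc ℓ)) m t) ⟨
  m * t 0 + ∑ (suc ℓ) (λ i → m * t (suc i)) + ∑ (suc ℓ) shifted
    ≡⟨ +-assoc (m * t 0) _ _ ⟩
  m * t 0 + (∑ (suc ℓ) (λ i → m * t (suc i)) + ∑ (suc ℓ) shifted)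
    ≡⟨ cong₂ _+_ first (trans (sym (∑-+ (suc ℓ) (λ i → m * t (suc i)) shifted)) (∑-cong (suc ℓ) pascal)) ⟩
  (suc ℓ C 0) * m ^ suc ℓ * χ 0 + ∑ (suc ℓ) (λ i → (suc ℓ C suc i) * m ^ (ℓ ∸ i) * χ (suc i)) ∎
  where
  open ≡-Reasoning
  t shifted : ℕ → ℕ
  t i = (ℓ C i) * m ^ (ℓ ∸ i) * χ i
  shifted i = (ℓ C i) * m ^ (ℓ ∸ i) * χ (suc i)
  -- A vanishing summand is appended so that, once the first summand is split off, both sums have
  -- the same range and Pascal's rule applies index by index.
  extend : ∑ (suc ℓ) t ≡ ∑ (suc (suc ℓ)) t
  extend = sym (trans (∑-snoc (suc ℓ) t)
    (trans (cong (λ c → ∑ (suc ℓ) t + c * m ^ (ℓ ∸ suc ℓ) * χ (suc ℓ)) (k>n⇒nCk≡0 (n<1+n ℓ)))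
           (+-identityʳ _)))
  first : m * t 0 ≡ (suc ℓ C 0) * m ^ suc ℓ * χ 0
  first = trans (cong (λ c → m * (c * m ^ ℓ * χ 0)) (nC0≡1 ℓ))
         (trans (regroup m (m ^ ℓ) (χ 0)) (cong (λ c → c * m ^ suc ℓ * χ 0) (sym (nC0≡1 (suc ℓ)))))
    where
    regroup : ∀ m p x → m * (1 * p * x) ≡ 1 * (m * p) * x
    regroup = solve-∀
  -- For `i ≥ ℓ` truncated subtraction spoils the exponent law, but then the coefficient `ℓ C suc i`
  -- is zero.
  lower : ∀ i → m * t (suc i) ≡ (ℓ C suc i) * m ^ (ℓ ∸ i) * χ (suc i)
  lower i with i <? ℓ
  ... | yes i<ℓ = trans (regroup m (ℓ C suc i) (m ^ (ℓ ∸ suc i)) (χ (suc i)))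
                        (cong (λ e → (ℓ C suc i) * m ^ e * χ (suc i)) (sym (+-∸-assoc 1 i<ℓ)))
    where
    regroup : ∀ m c p x → m * (c * p * x) ≡ c * (m * p) * x
    regroup = solve-∀
  ... | no i≮ℓ = trans (cong (λ c → m * (c * m ^ (ℓ ∸ suc i) * χ (suc i))) c≡0)
                (trans (*-zeroʳ m) (cong (λ c → c * m ^ (ℓ ∸ i) * χ (suc i)) (sym c≡0)))
    where
    c≡0 : ℓ C suc i ≡ 0
    c≡0 = k>n⇒nCk≡0 (s≤s (≮⇒≥ i≮ℓ))
  pascal : ∀ i → m * t (suc i) + shifted i ≡ (suc ℓ C suc i) * m ^ (ℓ ∸ i) * χ (suc i)
  pascal i = trans (cong (_+ shifted i) (lower i))
            (trans (regroup (ℓ C i) (ℓ C suc i) (m ^ (ℓ ∸ i)) (χ (suc i)))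
                   (cong (λ c → c * m ^ (ℓ ∸ i) * χ (suc i)) (nCk+nC[k+1]≡[n+1]C[k+1] ℓ i)))
    where
    regroup : ∀ c d p x → d * p * x + c * p * x ≡ (c + d) * p * x
    regroup = solve-∀

-- Reflection of the power sums about the centre m = n + k.

-- By mutual recursion, shifting the index i is multiplication by j.
oddPow evenPow : ℕ → ℕ → ℕ
oddPow  j zero    = 0
oddPow  j (suc i) = j * evenPow j i
evenPow j zero    = 1
evenPow j (suc i) = j * oddPow j i

evenPow-even : ∀ j f → evenPow j (f * 2) ≡ j ^ (f * 2)
evenPow-even j zero    = refl
evenPow-even j (suc f) = cong (λ x → j * (j * x)) (evenPow-even j f)

oddPow-odd : ∀ j f → oddPow j (suc (f * 2)) ≡ j ^ suc (f * 2)
oddPow-odd j f = cong (j *_) (evenPow-even j f)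

oddPow-even : ∀ j f → oddPow j (f * 2) ≡ 0
oddPow-even j zero    = refl
oddPow-even j (suc f) =
  trans (cong (λ x → j * (j * x)) (oddPow-even j f)) (trans (cong (j *_) (*-zeroʳ j)) (*-zeroʳ j))

umbral-oddPow-suc : ∀ ℓ m j → umbral (suc ℓ) m (oddPow j) ≡ m * umbral ℓ m (oddPow j) + j * umbral ℓ m (evenPow j)
umbral-oddPow-suc ℓ m j = cong (m * umbral ℓ m (oddPow j) +_) (umbral-*ˡ ℓ m j (evenPow j))

umbral-evenPow-suc : ∀ ℓ m j → umbral (suc ℓ) m (evenPow j) ≡ m * umbral ℓ m (evenPow j) + j * umbral ℓ m (oddPow j)
umbral-evenPow-suc ℓ m j = cong (m * umbral ℓ m (evenPow j) +_) (umbral-*ˡ ℓ m j (oddPow j))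

^-sum : ∀ ℓ m j → (m + j) ^ ℓ ≡ umbral ℓ m (evenPow j) + umbral ℓ m (oddPow j)
^-sum zero    m j = refl
^-sum (suc ℓ) m j = begin
  (m + j) * (m + j) ^ ℓ             ≡⟨ cong ((m + j) *_) (^-sum ℓ m j) ⟩
  (m + j) * (e + o)                 ≡⟨ expand m j e o ⟩
  m * e + j * o + (m * o + j * e)   ≡⟨ cong₂ _+_ (umbral-evenPow-suc ℓ m j) (umbral-oddPow-suc ℓ m j) ⟨
  umbral (suc ℓ) m (evenPow j) + umbral (suc ℓ) m (oddPow j) ∎
  where
  open ≡-Reasoning
  e = umbral ℓ m (evenPow j)
  o = umbral ℓ m (oddPow j)
  expand : ∀ m j e o → (m + j) * (e + o) ≡ m * e + j * o + (m * o + j * e)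
  expand = solve-∀

-- This is the expansion of (m - j)^ℓ with m = p + j: the odd powers of j enter with a minus sign
-- and are moved to the other side.
^-difference : ∀ ℓ p j → p ^ ℓ + umbral ℓ (p + j) (oddPow j) ≡ umbral ℓ (p + j) (evenPow j)
^-difference zero    p j = refl
^-difference (suc ℓ) p j = begin
  p * p ^ ℓ + umbral (suc ℓ) m (oddPow j)
    ≡⟨ cong (p * p ^ ℓ +_) (umbral-oddPow-suc ℓ m j) ⟩
  p * p ^ ℓ + (m * o + j * e)
    ≡⟨ cong (λ x → p * p ^ ℓ + (m * o + j * x)) (^-difference ℓ p j) ⟨
  p * p ^ ℓ + (m * o + j * (p ^ ℓ + o))
    ≡⟨ regroup p j (p ^ ℓ) o ⟩
  m * (p ^ ℓ + o) + j * o
    ≡⟨ cong (λ x → m * x + j * o) (^-difference ℓ p j) ⟩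
  m * e + j * o
    ≡⟨ umbral-evenPow-suc ℓ m j ⟨
  umbral (suc ℓ) m (evenPow j) ∎
  where
  open ≡-Reasoning
  m = p + j
  e = umbral ℓ m (evenPow j)
  o = umbral ℓ m (oddPow j)
  regroup : ∀ p j P o → p * P + ((p + j) * o + j * (P + o)) ≡ (p + j) * (P + o) + j * o
  regroup = solve-∀

-- This is S i for odd `i` and 0 for even `i`, so a sum over all indices selects the odd ones.
oddPowSum : ℕ → ℕ → ℕ
oddPowSum k i = ∑ k (λ j → oddPow (suc j) i)

powSum-snoc : ∀ a k ℓ → powSum a (suc k) ℓ ≡ powSum a k ℓ + (a + k) ^ ℓ
powSum-snoc a zero    ℓ = trans (+-identityʳ _) (cong (_^ ℓ) (sym (+-identityʳ a)))
powSum-snoc a (suc k) ℓ = begin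
  a ^ ℓ + powSum (suc a) (suc k) ℓ                 ≡⟨ cong (a ^ ℓ +_) (powSum-snoc (suc a) k ℓ) ⟩
  a ^ ℓ + (powSum (suc a) k ℓ + (suc a + k) ^ ℓ)   ≡⟨ +-assoc (a ^ ℓ) _ _ ⟨
  powSum a (suc k) ℓ + (suc a + k) ^ ℓ             ≡⟨ cong (λ b → powSum a (suc k) ℓ + b ^ ℓ) (+-suc a k) ⟨
  powSum a (suc k) ℓ + (a + suc k) ^ ℓ             ∎
  where open ≡-Reasoning

umbral-0 : ∀ ℓ m → umbral ℓ m (λ _ → 0) ≡ 0
umbral-0 ℓ m = umbral-*ˡ ℓ m 0 (λ _ → 0)

-- Induction outwards from a fixed centre m: the new outermost pair is m - (k+1) and m + (k+1),
-- whose ℓ-th powers differ by twice the odd part of the expansion.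
powSum-reflect : ∀ ℓ k n →
  powSum (suc (n + k)) k ℓ ≡ powSum n k ℓ + 2 * umbral ℓ (n + k) (oddPowSum k)
powSum-reflect ℓ zero    n = sym (cong (2 *_) (umbral-0 ℓ (n + 0)))
powSum-reflect ℓ (suc k) n = begin
  powSum (suc m) (suc k) ℓ
    ≡⟨ powSum-snoc (suc m) k ℓ ⟩
  powSum (suc m) k ℓ + (suc m + k) ^ ℓ
    ≡⟨ cong₂ _+_ shrink (cong (_^ ℓ) (sym (+-suc m k))) ⟩
  (powSum (suc n) k ℓ + 2 * u) + (m + suc k) ^ ℓ
    ≡⟨ cong ((powSum (suc n) k ℓ + 2 * u) +_) (^-sum ℓ m (suc k)) ⟩
  (powSum (suc n) k ℓ + 2 * u) + (e + o)
    ≡⟨ cong (λ x → (powSum (suc n) k ℓ + 2 * u) + (x + o)) (^-difference ℓ n (suc k)) ⟨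
  (powSum (suc n) k ℓ + 2 * u) + (n ^ ℓ + o + o)
    ≡⟨ regroup (powSum (suc n) k ℓ) u (n ^ ℓ) o ⟩
  powSum n (suc k) ℓ + 2 * (u + o)
    ≡⟨ cong (λ x → powSum n (suc k) ℓ + 2 * x) (umbral-+ ℓ m (oddPowSum k) (oddPow (suc k))) ⟨
  powSum n (suc k) ℓ + 2 * umbral ℓ m (λ i → oddPowSum k i + oddPow (suc k) i)
    ≡⟨ cong (λ x → powSum n (suc k) ℓ + 2 * x) (umbral-cong ℓ m (λ i → ∑-snoc k (λ j → oddPow (suc j) i))) ⟨
  powSum n (suc k) ℓ + 2 * umbral ℓ m (oddPowSum (suc k)) ∎
  where
  open ≡-Reasoning
  m = n + suc k
  u = umbral ℓ m (oddPowSum k)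
  e = umbral ℓ m (evenPow (suc k))
  o = umbral ℓ m (oddPow (suc k))
  -- Replacing (n, k + 1) by (n + 1, k) keeps the centre, since `suc n + k` equals `n + suc k`.
  shrink : powSum (suc m) k ℓ ≡ powSum (suc n) k ℓ + 2 * u
  shrink = subst (λ x → powSum (suc x) k ℓ ≡ powSum (suc n) k ℓ + 2 * umbral ℓ x (oddPowSum k))
             (sym (+-suc n k)) (powSum-reflect ℓ k (suc n))
  regroup : ∀ s u p o → (s + 2 * u) + (p + o + o) ≡ p + s + 2 * (u + o)
  regroup = solve-∀

term : ℕ → ℕ → ℕ → ℕ → ℕ
term ℓ k m i = 2 * ((ℓ C i) * m ^ (ℓ ∸ i) * oddPowSum k i)

-- After reflection the k powers below the centre occur on both sides and cancel.
centre-equation : ∀ ℓ k n → powSum n (k + 1) ℓ ≡ powSum (n + k + 1) k ℓ →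
  (n + k) ^ ℓ ≡ ∑ (suc ℓ) (term ℓ k (n + k))
centre-equation ℓ k n h = +-cancelˡ-≡ (powSum n k ℓ) _ _ (begin
  powSum n k ℓ + m ^ ℓ             ≡⟨ powSum-snoc n k ℓ ⟨
  powSum n (suc k) ℓ               ≡⟨ cong (λ x → powSum n x ℓ) (+-comm k 1) ⟨
  powSum n (k + 1) ℓ               ≡⟨ h ⟩
  powSum (m + 1) k ℓ               ≡⟨ cong (λ x → powSum x k ℓ) (+-comm m 1) ⟩
  powSum (suc m) k ℓ               ≡⟨ powSum-reflect ℓ k n ⟩
  powSum n k ℓ + 2 * umbral ℓ m (oddPowSum k)
    ≡⟨ cong (λ x → powSum n k ℓ + 2 * x) (umbral-expand ℓ m (oddPowSum k)) ⟩
  powSum n k ℓ + 2 * ∑ (suc ℓ) (λ i → (ℓ C i) * m ^ (ℓ ∸ i) * oddPowSum k i)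
    ≡⟨ cong (powSum n k ℓ +_) (∑-*ˡ (suc ℓ) 2 (λ i → (ℓ C i) * m ^ (ℓ ∸ i) * oddPowSum k i)) ⟨
  powSum n k ℓ + ∑ (suc ℓ) (term ℓ k m) ∎)
  where
  open ≡-Reasoning
  m = n + k

-- Closed forms and 2-adic valuations of the odd power sums.

∑-0 : ∀ k {f : ℕ → ℕ} → (∀ i → f i ≡ 0) → ∑ k f ≡ 0
∑-0 zero    h = refl
∑-0 (suc k) h = cong₂ _+_ (h 0) (∑-0 k (h ∘ suc))

oddPowSum-even : ∀ k f → oddPowSum k (f * 2) ≡ 0
oddPowSum-even k f = ∑-0 k (λ j → oddPow-even (suc j) f)

oddPowSum-odd : ∀ k f → oddPowSum k (suc (f * 2)) ≡ ∑ (suc k) (_^ suc (f * 2))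
oddPowSum-odd k f = ∑-cong k (λ j → oddPow-odd (suc j) f)

oddPowSum-2+ : ∀ k i → oddPowSum k (2 + i) ≤ k * k * oddPowSum k i
oddPowSum-2+ k i = ≤-trans
  (∑-mono k (λ j j<k → ≤-trans (≤-reflexive (sym (*-assoc (suc j) (suc j) _)))
                          (*-monoˡ-≤ (oddPow (suc j) i) (*-mono-≤ j<k j<k))))
  (≤-reflexive (∑-*ˡ k (k * k) (λ j → oddPow (suc j) i)))

2*oddPowSum₁ : ∀ k → 2 * oddPowSum k 1 ≡ k * suc k
2*oddPowSum₁ zero    = refl
2*oddPowSum₁ (suc k) = begin
  2 * oddPowSum (suc k) 1           ≡⟨ cong (2 *_) (∑-snoc k (λ j → oddPow (suc j) 1)) ⟩
  2 * (oddPowSum k 1 + suc k * 1)   ≡⟨ *-distribˡ-+ 2 (oddPowSum k 1) _ ⟩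
  2 * oddPowSum k 1 + 2 * (suc k * 1) ≡⟨ cong (_+ 2 * (suc k * 1)) (2*oddPowSum₁ k) ⟩
  k * suc k + 2 * (suc k * 1)       ≡⟨ regroup k ⟩
  suc k * suc (suc k)               ∎
  where
  open ≡-Reasoning
  regroup : ∀ k → k * suc k + 2 * (suc k * 1) ≡ suc k * suc (suc k)
  regroup = solve-∀

-- Nicomachus: the sum of cubes is the square of the triangular number.
4*oddPowSum₃ : ∀ k → 4 * oddPowSum k 3 ≡ k * suc k * (k * suc k)
4*oddPowSum₃ zero    = refl
4*oddPowSum₃ (suc k) = begin
  4 * oddPowSum (suc k) 3           ≡⟨ cong (4 *_) (∑-snoc k (λ j → oddPow (suc j) 3)) ⟩
  4 * (oddPowSum k 3 + c)           ≡⟨ *-distribˡ-+ 4 (oddPowSum k 3) _ ⟩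
  4 * oddPowSum k 3 + 4 * c         ≡⟨ cong (_+ 4 * c) (4*oddPowSum₃ k) ⟩
  k * suc k * (k * suc k) + 4 * c   ≡⟨ regroup k ⟩
  suc k * suc (suc k) * (suc k * suc (suc k)) ∎
  where
  open ≡-Reasoning
  c = suc k * (suc k * (suc k * 1))
  regroup : ∀ k → k * suc k * (k * suc k) + 4 * (suc k * (suc k * (suc k * 1)))
    ≡ suc k * suc (suc k) * (suc k * suc (suc k))
  regroup = solve-∀

exact-exponent : ∀ x → 1 ≤ x → ∃ λ t → Exact t x
exact-exponent = <-rec (λ x → 1 ≤ x → ∃ λ t → Exact t x) go
  where
  go : ∀ x → (∀ {y} → y < x → 1 ≤ y → ∃ λ t → Exact t y) → 1 ≤ x → ∃ λ t → Exact t x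
  go x rec 1≤x with even⊎odd x
  ... | inj₂ (u , refl) = 0 , Exact-odd u
  ... | inj₁ (suc u , refl) with rec (m<m*n (suc u) 2 (s<s z<s)) z<s
  ... | t , odd-part w p = suc t , odd-part w
          (trans (*-comm (suc u) 2) (trans (cong (2 *_) p) (sym (*-assoc 2 (2 ^ t) _))))

record OddPowSums (a k : ℕ) : Set where
  field
    size    : 2 ^ suc a ≤ suc k
    linear  : 2 ^ a ∣ oddPowSum k 1
    higher  : ∀ f → Exact (a + a) (oddPowSum k (suc (suc f * 2)))

-- Let M be the even one of `k` and `suc k`, and let 2^(a+1) be its exact power of 2. If M = k + 1,
-- the sum is already one over `j < M`. If M = k, the one further summand M^i is a multiple of M²,
-- hence of 2^(2a+1), and leaves the valuation 2a unchanged. The linear sum is read off from 2 S 1 =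
-- k (k + 1).
oddPowSum-2-adic : ∀ k → 1 ≤ k → ∃ λ a → OddPowSums a k
oddPowSum-2-adic k 1≤k with even⊎odd k
... | inj₁ (suc u , k≡) with exact-exponent (suc u) z<s
... | a , odd-part q p = a , record
  { size   = ≤-trans (subst (2 ^ suc a ≤_) M≡k (m≤m*n (2 ^ suc a) (suc (q * 2)))) (n≤1+n k)
  ; linear = *-cancelˡ-∣ 2 (subst (2 ^ suc a ∣_) (sym (2*oddPowSum₁ k))
               (∣m⇒∣m*n (suc k) (subst (2 ^ suc a ∣_) M≡k (m∣m*n (suc (q * 2))))))
  ; higher = λ f → subst (Exact (a + a)) (sym (oddPowSum-odd k (suc f)))
               (subst (λ x → Exact (a + a) (∑ (suc x) (_^ suc (suc f * 2)))) M≡k (above f))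
  }
  where
  M = 2 ^ suc a * suc (q * 2)
  M≡k : M ≡ k
  M≡k = sym (trans k≡ (trans (*-comm (suc u) 2) (trans (cong (2 *_) p) (sym (*-assoc 2 (2 ^ a) _)))))
  2∣MM : 2 ^ suc (a + a) ∣ M * M
  2∣MM = subst (_∣ M * M) (cong (2 ^_) (+-suc a a)) (subst (_∣ M * M) (sym (^-distribˡ-+-* 2 a (suc a)))
      (*-pres-∣ (∣-trans (2^t∣2^1+t a) (m∣m*n {2 ^ suc a} (suc (q * 2)))) (m∣m*n {2 ^ suc a} (suc (q * 2)))))
  above : ∀ f → Exact (a + a) (∑ (suc M) (_^ suc (suc f * 2)))
  above f = subst (Exact (a + a)) (sym (∑-snoc M (_^ suc (suc f * 2))))
    (Exact-Cong (cancelling 0 (M ^ suc (f * 2)) (regroup (∑ M (_^ suc (suc f * 2))) M (M ^ suc (f * 2))))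
      2∣MM (Exact-∑-odd-^ a q f))
    where
    regroup : ∀ s M c → s + M * (M * c) + M * M * 0 ≡ s + M * M * c
    regroup = solve-∀
oddPowSum-2-adic k 1≤k | inj₁ (zero , refl) with () ← 1≤k
oddPowSum-2-adic k 1≤k | inj₂ (u , k≡) with exact-exponent (suc u) z<s
... | a , odd-part q p = a , record
  { size   = subst (2 ^ suc a ≤_) M≡ (m≤m*n (2 ^ suc a) (suc (q * 2)))
  ; linear = *-cancelˡ-∣ 2 (subst (2 ^ suc a ∣_) (sym (2*oddPowSum₁ k))
               (∣n⇒∣m*n k (subst (2 ^ suc a ∣_) M≡ (m∣m*n (suc (q * 2))))))
  ; higher = λ f → subst (Exact (a + a)) (sym (oddPowSum-odd k (suc f)))
               (subst (λ x → Exact (a + a) (∑ x (_^ suc (suc f * 2)))) M≡ (Exact-∑-odd-^ a q f))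
  }
  where
  M≡ : 2 ^ suc a * suc (q * 2) ≡ suc k
  M≡ = sym (trans (cong suc k≡) (trans (*-comm (suc u) 2) (trans (cong (2 *_) p) (sym (*-assoc 2 (2 ^ a) _)))))

-- The 2-adic lower bound on k.

absorption : ∀ n i → suc i * (suc n C suc i) ≡ suc n * (n C i)
absorption zero    zero    = refl
absorption zero    (suc i) = trans (cong (suc (suc i) *_) (k>n⇒nCk≡0 {1} {suc (suc i)} (s<s z<s)))
                                   (*-zeroʳ (suc (suc i)))
absorption (suc n) zero    = begin
  1 * (suc (suc n) C 1)      ≡⟨ *-identityˡ _ ⟩
  suc (suc n) C 1            ≡⟨ nC1≡n (suc (suc n)) ⟩
  suc (suc n)                ≡⟨ *-identityʳ _ ⟨
  suc (suc n) * 1            ≡⟨ cong (suc (suc n) *_) (nC0≡1 (suc n)) ⟨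
  suc (suc n) * (suc n C 0)  ∎
  where open ≡-Reasoning
absorption (suc n) (suc i) = begin
  (2 + i) * (suc (suc n) C suc (suc i))
    ≡⟨ cong ((2 + i) *_) (nCk+nC[k+1]≡[n+1]C[k+1] (suc n) (suc i)) ⟨
  (2 + i) * (c + d)
    ≡⟨ regroup i c d ⟩
  c + (suc i * c + (2 + i) * d)
    ≡⟨ cong (c +_) (cong₂ _+_ (absorption n i) (absorption n (suc i))) ⟩
  c + (suc n * (n C i) + suc n * (n C suc i))
    ≡⟨ cong (c +_) (*-distribˡ-+ (suc n) (n C i) (n C suc i)) ⟨
  c + suc n * (n C i + n C suc i)
    ≡⟨ cong (λ x → c + suc n * x) (nCk+nC[k+1]≡[n+1]C[k+1] n i) ⟩
  (2 + n) * c ∎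
  where
  open ≡-Reasoning
  c = suc n C suc i
  d = suc n C suc (suc i)
  regroup : ∀ i c d → (2 + i) * (c + d) ≡ c + (suc i * c + (2 + i) * d)
  regroup = solve-∀

2^∣odd*⇒2^∣ : ∀ v w x → 2 ^ v ∣ suc (w * 2) * x → 2 ^ v ∣ x
2^∣odd*⇒2^∣ zero    w x h = 1∣ x
2^∣odd*⇒2^∣ (suc v) w x h with 2^∣odd*⇒2^∣ v w x (∣-trans (2^t∣2^1+t v) h)
... | divides z refl with even⊎odd z
... | inj₁ (u , refl) = divides u (*-assoc u 2 (2 ^ v))
... | inj₂ (u , refl) = ⊥-elim (Exact⇒∤ (Exact-* {0} {v} (Exact-odd w) (odd-part u (*-comm (suc (u * 2)) (2 ^ v)))) h)

2^∣C-odd : ∀ v n g → 2 ^ v ∣ suc n → 2 ^ v ∣ suc n C suc (g * 2)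
2^∣C-odd v n g h = 2^∣odd*⇒2^∣ v g _ (subst (2 ^ v ∣_) (sym (absorption n (g * 2))) (∣m⇒∣m*n _ h))

∣-^ : ∀ {a b} r → a ∣ b → a ^ r ∣ b ^ r
∣-^ zero    h = ∣-refl
∣-^ (suc r) h = *-pres-∣ h (∣-^ r h)

^-∣-^ : ∀ b {m n} → m ≤ n → b ^ m ∣ b ^ n
^-∣-^ b {m} {n} m≤n =
  subst (b ^ m ∣_) (trans (sym (^-distribˡ-+-* b m (n ∸ m))) (cong (b ^_) (m+[n∸m]≡n m≤n)))
    (m∣m*n (b ^ (n ∸ m)))

∣-∑-except : ∀ {d} n f e → e < n → (∀ i → i < n → i ≢ e → d ∣ f i) → d ∣ ∑ n f → d ∣ f e
∣-∑-except {d} (suc n) f zero    _   h s =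
  ∣m+n∣m⇒∣n (subst (d ∣_) (+-comm (f 0) _) s) (∣-∑ n (f ∘ suc) (λ i i<n → h (suc i) (s<s i<n) (λ ())))
∣-∑-except (suc n) f (suc e) e<n h s =
  ∣-∑-except n (f ∘ suc) e (≤-pred e<n) (λ i i<n i≢e → h (suc i) (s<s i<n) (i≢e ∘ suc-injective))
    (∣m+n∣m⇒∣n s (h 0 z<s (λ ())))

term-even : ∀ ℓ k m g → term ℓ k m (g * 2) ≡ 0
term-even ℓ k m g = trans (cong (λ s → 2 * (c * s)) (oddPowSum-even k g)) (cong (2 *_) (*-zeroʳ c))
  where c = (ℓ C (g * 2)) * m ^ (ℓ ∸ g * 2)

term-> : ∀ ℓ k m i → ℓ < i → term ℓ k m i ≡ 0
term-> ℓ k m i ℓ<i = cong (λ c → 2 * (c * m ^ (ℓ ∸ i) * oddPowSum k i)) (k>n⇒nCk≡0 ℓ<i)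

-- e = 3 + 2f is the largest odd index up to ℓ, and h = ℓ - e; v plays the role of the valuation of ℓ.
module LastTermDominates
  {a k : ℕ} (S : OddPowSums a k) (m h f v : ℕ) (h≤1 : h ≤ 1) .{{_ : NonZero m}} where
  open OddPowSums S

  e ℓ t : ℕ
  e = suc (suc f * 2)
  ℓ = h + e
  -- One more than 1 + v + 2a, the valuation of the term of index `e` after `m ^ h` is removed.
  t = 2 + (v + (a + a))

  -- Here m^(ℓ-i) = m^h m^r. The powers of 2 in the leading factor 2, the binomial coefficient, m^r
  -- and S i add up, while m^h is kept as a common factor to be cancelled later.
  term-∣ : ∀ i r p s → i + r ≡ e → 2 ∣ m → 2 ^ v ∣ ℓ C i → 2 ^ p ∣ m ^ r → 2 ^ s ∣ oddPowSum k i →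
    t ≤ suc (v + (p + s)) → 2 ^ t * m ^ h ∣ term ℓ k m i
  term-∣ i r p s i+r≡e 2∣m 2∣C 2∣m^r 2∣S t≤ =
    subst (2 ^ t * m ^ h ∣_) factor (*-monoˡ-∣ (m ^ h) (∣-trans (^-∣-^ 2 t≤) product))
    where
    product : 2 ^ suc (v + (p + s)) ∣ 2 * ((ℓ C i) * (m ^ r * oddPowSum k i))
    product = *-monoʳ-∣ 2 (subst (_∣ (ℓ C i) * (m ^ r * oddPowSum k i)) (sym (^-distribˡ-+-* 2 v (p + s)))
      (*-pres-∣ 2∣C (subst (_∣ m ^ r * oddPowSum k i) (sym (^-distribˡ-+-* 2 p s)) (*-pres-∣ 2∣m^r 2∣S))))
    exponent : ℓ ∸ i ≡ h + r
    exponent = trans (cong (λ x → h + x ∸ i) (sym i+r≡e)) (trans (cong (_∸ i) (swap h i r)) (m+n∸m≡n i (h + r)))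
      where
      swap : ∀ h i r → h + (i + r) ≡ i + (h + r)
      swap = solve-∀
    regroup : ∀ c y x s → 2 * (c * (x * s)) * y ≡ 2 * (c * (y * x) * s)
    regroup = solve-∀
    factor : 2 * ((ℓ C i) * (m ^ r * oddPowSum k i)) * m ^ h ≡ term ℓ k m i
    factor = trans (regroup (ℓ C i) (m ^ h) (m ^ r) (oddPowSum k i))
      (cong (λ x → 2 * ((ℓ C i) * x * oddPowSum k i)) (trans (sym (^-distribˡ-+-* m h r)) (cong (m ^_) (sym exponent))))

  other-terms : t ≤ e → 2 ∣ m → (∀ g → 2 ^ v ∣ ℓ C suc (g * 2)) →
    ∀ i → i ≢ e → 2 ^ t * m ^ h ∣ term ℓ k m i
  other-terms t≤e 2∣m 2∣C i i≢e with even⊎odd i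
  ... | inj₁ (g , refl) = subst (2 ^ t * m ^ h ∣_) (sym (term-even ℓ k m g)) (_ ∣0)
  -- For i = 1 the power m^(e-1) alone supplies 2^(e-1), and with the leading 2 this reaches 2^e.
  ... | inj₂ (zero , refl) =
    term-∣ 1 (suc f * 2) (suc f * 2) a refl 2∣m (2∣C 0) (∣-^ (suc f * 2) 2∣m) linear
      (≤-trans t≤e (s≤s (≤-trans (m≤m+n (suc f * 2) a) (m≤n+m _ v))))
  ... | inj₂ (suc g , refl) with <-cmp g f
  ... | tri≈ _ refl _ = ⊥-elim (i≢e refl)
  -- An odd index beyond `e` is at least e + 2, which exceeds ℓ because `h ≤ 1`.
  ... | tri> _ _ f<g = subst (2 ^ t * m ^ h ∣_)
    (sym (term-> ℓ k m (suc (suc g * 2)) (s≤s (≤-trans (+-monoˡ-≤ e h≤1) (s≤s (s≤s (*-monoˡ-≤ 2 f<g))))))) (_ ∣0)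
  ... | tri< g<f _ _ =
    -- For odd i with 3 ≤ i < e the exponent e - i is at least 2, so m² supplies an additional
    -- factor 4.
    term-∣ (suc (suc g * 2)) (suc (d * 2)  + 1) 2 (a + a) split 2∣m (2∣C (suc g))
      (∣-trans (∣-^ 2 2∣m) (^-∣-^ m (two≤ d))) (Exact⇒∣ (higher g)) (slack v a)
    where
    d = f ∸ suc g
    two≤ : ∀ d → 2 ≤ suc (d * 2) + 1
    two≤ d = s≤s (m≤n+m 1 (d * 2))
    slack : ∀ v a → 2 + (v + (a + a)) ≤ suc (v + (2 + (a + a)))
    slack v a = s≤s (≤-trans (n≤1+n _) (≤-reflexive (trans (cong suc (sym (+-suc v (a + a)))) (sym (+-suc v (suc (a + a)))))))
    split : suc (suc g * 2) + (suc (d * 2) + 1) ≡ e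
    split = trans (regroup g d) (cong (λ x → suc (suc x * 2)) (m+[n∸m]≡n g<f))
      where
      regroup : ∀ g d → suc (suc g * 2) + (suc (d * 2) + 1) ≡ suc (suc (suc g + d) * 2)
      regroup = solve-∀

  -- The factor 2 in every term makes m even. If t ≤ e, then 2^t m^h divides m^ℓ and all terms
  -- except that of index `e`, hence that one too, against its exact valuation. So e < t and ℓ ≤ t,
  -- and 2^t = 2^v (2^(a+1))² is bounded by the sizes of ℓ and k + 1.
  growth : m ^ ℓ ≡ ∑ (suc ℓ) (term ℓ k m) → (∀ g → 2 ^ v ∣ ℓ C suc (g * 2)) → Exact v (ℓ C e) → 2 ^ v ≤ ℓ →
    2 ^ ℓ ≤ ℓ * (suc k * suc k)
  growth eq 2∣C exact 2^v≤ℓ = begin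
    2 ^ ℓ                                ≤⟨ ^-monoʳ-≤ 2 (≤-trans (+-monoˡ-≤ e h≤1) (≰⇒> t≰e)) ⟩
    2 ^ t                                ≡⟨ cong (2 ^_) (exponent v a) ⟩
    2 ^ (v + (suc a + suc a))            ≡⟨ ^-distribˡ-+-* 2 v (suc a + suc a) ⟩
    2 ^ v * 2 ^ (suc a + suc a)          ≡⟨ cong (2 ^ v *_) (^-distribˡ-+-* 2 (suc a) (suc a)) ⟩
    2 ^ v * (2 ^ suc a * 2 ^ suc a)      ≤⟨ *-mono-≤ 2^v≤ℓ (*-mono-≤ size size) ⟩
    ℓ * (suc k * suc k)                  ∎
    where
    open ≤-Reasoning
    exponent : ∀ v a → 2 + (v + (a + a)) ≡ v + (suc a + suc a)
    exponent = solve-∀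
    2∣m : 2 ∣ m
    2∣m = 2∣^⇒2∣ m ℓ (subst (2 ∣_) (sym eq) (∣-∑ (suc ℓ) (term ℓ k m) (λ i _ → m∣m*n ((ℓ C i) * m ^ (ℓ ∸ i) * oddPowSum k i))))
    last : Exact (suc (v + (a + a))) (2 * ((ℓ C e) * oddPowSum k e))
    last = Exact-* {1} {v + (a + a)} (odd-part 0 refl) (Exact-* {v} {a + a} exact (higher f))
    t≰e : ¬ t ≤ e
    t≰e t≤e = Exact⇒∤ last (*-cancelʳ-∣ (m ^ h) {{m^n≢0 m h}} (subst (2 ^ t * m ^ h ∣_) factor
      (∣-∑-except (suc ℓ) (term ℓ k m) e (s≤s (m≤n+m e h)) (λ i _ → other-terms t≤e 2∣m 2∣C i)
        (subst (2 ^ t * m ^ h ∣_) (trans (trans (*-comm (m ^ e) (m ^ h)) (sym (^-distribˡ-+-* m h e))) eq)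
          (*-monoˡ-∣ (m ^ h) (∣-trans (^-∣-^ 2 t≤e) (∣-^ e 2∣m)))))))
      where
      regroup : ∀ c y s → 2 * (c * y * s) ≡ 2 * (c * s) * y
      regroup = solve-∀
      factor : term ℓ k m e ≡ 2 * ((ℓ C e) * oddPowSum k e) * m ^ h
      factor = trans (cong (λ x → 2 * ((ℓ C e) * m ^ x * oddPowSum k e)) (m+n∸n≡m h e))
                     (regroup (ℓ C e) (m ^ h) (oddPowSum k e))

-- For odd ℓ the last odd index is ℓ, with coefficient 1 and v = 0. For even ℓ it is ℓ - 1, with
-- coefficient ℓ, so v is the valuation of ℓ.
2^ℓ-bound : ∀ ℓ k m → 3 ≤ ℓ → 1 ≤ k → .{{_ : NonZero m}} → m ^ ℓ ≡ ∑ (suc ℓ) (term ℓ k m) →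
  2 ^ ℓ ≤ ℓ * (suc k * suc k)
2^ℓ-bound ℓ k m 3≤ℓ 1≤k eq with oddPowSum-2-adic k 1≤k | even⊎odd ℓ
... | a , S | inj₂ (suc f , refl) =
  LastTermDominates.growth S m 0 f 0 z≤n eq (λ _ → 1∣ _) (odd-part 0 (nCn≡1 (suc (suc f * 2)))) z<s
... | a , S | inj₂ (zero , refl) with s≤s () ← 3≤ℓ
2^ℓ-bound ℓ k m 3≤ℓ 1≤k eq | a , S | inj₁ (suc (suc f) , refl) with exact-exponent (suc (suc f) * 2) z<s
... | v , exact = LastTermDominates.growth S m 1 f v ≤-refl eq
  (λ g → 2^∣C-odd v (suc (suc f * 2)) g (Exact⇒∣ exact))
  (subst (Exact v) (sym C≡ℓ) exact) (∣⇒≤ (Exact⇒∣ exact))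
  where
  n = suc (suc f * 2)
  C≡ℓ : suc n C n ≡ suc n
  C≡ℓ = trans (nCk≡nC[n∸k] (n≤1+n n)) (trans (cong (suc n C_) (m+n∸n≡m 1 n)) (nC1≡n (suc n)))
2^ℓ-bound ℓ k m 3≤ℓ 1≤k eq | a , S | inj₁ (suc zero , refl) with s≤s (s≤s ()) ← 3≤ℓ
2^ℓ-bound ℓ k m 3≤ℓ 1≤k eq | a , S | inj₁ (zero , refl) with () ← 3≤ℓ

-- Geometric decay of the terms and growth of 2^ℓ.

C-monoˡ : ∀ n i → n C i ≤ suc n C i
C-monoˡ n zero    = ≤-reflexive (trans (nC0≡1 n) (sym (nC0≡1 (suc n))))
C-monoˡ n (suc i) = subst (n C suc i ≤_) (nCk+nC[k+1]≡[n+1]C[k+1] n i) (m≤n+m (n C suc i) (n C i))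

C-suc-≤ : ∀ n i → suc n C suc i ≤ suc n * (suc n C i)
C-suc-≤ n i = begin
  suc n C suc i             ≤⟨ m≤n*m (suc n C suc i) (suc i) ⟩
  suc i * (suc n C suc i)   ≡⟨ absorption n i ⟩
  suc n * (n C i)           ≤⟨ *-monoʳ-≤ (suc n) (C-monoˡ n i) ⟩
  suc n * (suc n C i)       ∎
  where open ≤-Reasoning

C-2+-≤ : ∀ n i → suc n C (2 + i) ≤ suc n * suc n * (suc n C i)
C-2+-≤ n i = begin
  suc n C (2 + i)                   ≤⟨ C-suc-≤ n (suc i) ⟩
  suc n * (suc n C suc i)           ≤⟨ *-monoʳ-≤ (suc n) (C-suc-≤ n i) ⟩
  suc n * (suc n * (suc n C i))     ≡⟨ *-assoc (suc n) (suc n) _ ⟨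
  suc n * suc n * (suc n C i)       ∎
  where open ≤-Reasoning

6*nC3 : ∀ n → 6 * ((3 + n) C 3) ≡ (3 + n) * ((2 + n) * (1 + n))
6*nC3 n = begin
  6 * ((3 + n) C 3)                    ≡⟨ *-assoc 2 3 ((3 + n) C 3) ⟩
  2 * (3 * ((3 + n) C 3))              ≡⟨ cong (2 *_) (absorption (2 + n) 2) ⟩
  2 * ((3 + n) * ((2 + n) C 2))        ≡⟨ swap n ((2 + n) C 2) ⟩
  (3 + n) * (2 * ((2 + n) C 2))        ≡⟨ cong ((3 + n) *_) (absorption (1 + n) 1) ⟩
  (3 + n) * ((2 + n) * ((1 + n) C 1))  ≡⟨ cong (λ c → (3 + n) * ((2 + n) * c)) (nC1≡n (1 + n)) ⟩
  (3 + n) * ((2 + n) * (1 + n))        ∎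
  where
  open ≡-Reasoning
  swap : ∀ n c → 2 * ((3 + n) * c) ≡ (3 + n) * (2 * c)
  swap = solve-∀

∑-drop-2 : ∀ n f → ∑ n f ≤ f 0 + (f 1 + ∑ n (f ∘ (2 +_)))
∑-drop-2 n f = ≤-trans (m≤m+n (∑ n f) _)
  (≤-reflexive (trans (sym (∑-split n 2 f)) (cong (λ x → ∑ x f) (+-comm n 2))))

-- Raising the index by 2 costs at most ℓ² in the binomial coefficient and k² in the power sum, and
-- loses m² ≥ (ℓ k (k+1))². The surplus is the factor (k+1)².
term-2+-≤ : ∀ n k m i → let ℓ = suc n in 2 + i ≤ ℓ → ℓ * (k * suc k) ≤ m →
  suc k * suc k * term ℓ k m (2 + i) ≤ term ℓ k m i
term-2+-≤ n k m i 2+i≤ℓ Q≤m = begin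
  K * (2 * ((ℓ C (2 + i)) * y * oddPowSum k (2 + i)))
    ≤⟨ *-monoʳ-≤ K (*-monoʳ-≤ 2 (*-mono-≤ (*-monoˡ-≤ y (C-2+-≤ n i)) (oddPowSum-2+ k i))) ⟩
  K * (2 * (ℓ * ℓ * (ℓ C i) * y * (k * k * oddPowSum k i)))
    ≡⟨ regroup ℓ k (ℓ C i) y (oddPowSum k i) ⟩
  2 * ((ℓ C i) * (ℓ * (k * suc k) * (ℓ * (k * suc k) * y)) * oddPowSum k i)
    ≤⟨ *-monoʳ-≤ 2 (*-monoˡ-≤ (oddPowSum k i) (*-monoʳ-≤ (ℓ C i) (*-mono-≤ Q≤m (*-monoˡ-≤ y Q≤m)))) ⟩
  2 * ((ℓ C i) * (m * (m * y)) * oddPowSum k i)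
    ≡⟨ cong (λ d → 2 * ((ℓ C i) * m ^ d * oddPowSum k i)) (+-∸-assoc 2 2+i≤ℓ) ⟨
  term ℓ k m i ∎
  where
  open ≤-Reasoning
  ℓ = suc n
  K = suc k * suc k
  y = m ^ (ℓ ∸ (2 + i))
  regroup : ∀ ℓ k c y s → suc k * suc k * (2 * (ℓ * ℓ * c * y * (k * k * s)))
    ≡ 2 * (c * (ℓ * (k * suc k) * (ℓ * (k * suc k) * y)) * s)
  regroup = solve-∀

-- The start at 12 is forced: 2 · 11³ = 2662 exceeds 2^11 = 2048.
2n³≤2^n : ∀ d → let n = 12 + d in n * (2 * (n * n)) ≤ 2 ^ n
2n³≤2^n zero    = ≤ᵇ⇒≤ 3456 4096 _
2n³≤2^n (suc d) = begin
  (13 + d) * (2 * ((13 + d) * (13 + d)))          ≤⟨ m≤m+n _ (2 * rest) ⟩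
  (13 + d) * (2 * ((13 + d) * (13 + d))) + 2 * rest  ≡⟨ identity d ⟩
  2 * ((12 + d) * (2 * ((12 + d) * (12 + d))))    ≤⟨ *-monoʳ-≤ 2 (2n³≤2^n d) ⟩
  2 * 2 ^ (12 + d)                                ∎
  where
  open ≤-Reasoning
  -- The expansion of 2 (12 + d)³ - (13 + d)³, whose coefficients are all positive.
  rest = d * d * d + 33 * (d * d) + 357 * d + 1259
  identity : ∀ d → (13 + d) * (2 * ((13 + d) * (13 + d))) + 2 * (d * d * d + 33 * (d * d) + 357 * d + 1259)
    ≡ 2 * ((12 + d) * (2 * ((12 + d) * (12 + d))))
  identity = solve-∀

-- Dividing 2ℓ³ ≤ 2^ℓ ≤ ℓ (k+1)² by ℓ gives 2ℓ² ≤ (k+1)², and k + 1 ≤ 2k.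
2^ℓ-bound⇒k-large : ∀ ℓ k → 1 ≤ k → 12 ≤ ℓ → 2 ^ ℓ ≤ ℓ * (suc k * suc k) → ℓ * ℓ ≤ k * suc k
2^ℓ-bound⇒k-large ℓ k 1≤k 12≤ℓ bound = *-cancelˡ-≤ 2 (begin
  2 * (ℓ * ℓ)         ≤⟨ *-cancelˡ-≤ ℓ {{>-nonZero (≤-trans z<s 12≤ℓ)}} (≤-trans cubic bound) ⟩
  suc k * suc k       ≤⟨ *-monoˡ-≤ (suc k) (+-mono-≤ 1≤k (≤-reflexive (sym (+-identityʳ k)))) ⟩
  2 * k * suc k       ≡⟨ *-assoc 2 k (suc k) ⟩
  2 * (k * suc k)     ∎)
  where
  open ≤-Reasoning
  cubic : ℓ * (2 * (ℓ * ℓ)) ≤ 2 ^ ℓ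
  cubic = subst (λ n → n * (2 * (n * n)) ≤ 2 ^ n) (m+[n∸m]≡n 12≤ℓ) (2n³≤2^n (ℓ ∸ 12))

-- The contradiction from the size of m - Q.

module SizeContradiction (n k : ℕ) (1≤k : 1 ≤ k)
  (large : 12 ≤ 3 + n → (3 + n) * (3 + n) ≤ k * suc k) where

  ℓ P Q H : ℕ
  ℓ = 3 + n
  P = (2 + n) * (1 + n)
  Q = ℓ * (k * suc k)
  -- This is (k+1)² - 1, the factor left after summing the geometric tail.
  H = k * (2 + k)

  P≡ : P ≡ ℓ * n + 2
  P≡ = identity n
    where
    identity : ∀ n → (2 + n) * (1 + n) ≡ (3 + n) * n + 2
    identity = solve-∀

  P<ℓℓ : P < ℓ * ℓ
  P<ℓℓ = subst (P <_) (identity n) (m≤m+n (suc P) (3 * n + 6))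
    where
    identity : ∀ n → suc ((2 + n) * (1 + n)) + (3 * n + 6) ≡ (3 + n) * (3 + n)
    identity = solve-∀

  -- In the application `Y` is m^(ℓ-3), `t₃` is the term of index 3 and `T` collects all later
  -- terms. Then `W` is m^(ℓ-1), and `R` is to be compared with `P`.
  module _ (r m Y t₃ T : ℕ) .{{m≢0 : NonZero m}} .{{_ : NonZero Y}}
    (1≤r : 1 ≤ r) (m≡ : m ≡ Q + r)
    (excess : r * (m * (m * Y)) ≡ t₃ + T)
    (third : 12 * ℓ * t₃ ≡ P * (Q * (Q * Y)))
    (tail : H * T ≤ t₃) where

    W R : ℕ
    W = m * (m * Y)
    R = 12 * ℓ * r

    instance
      W≢0 : NonZero W
      W≢0 = m*n≢0 m (m * Y) {{m≢0}} {{m*n≢0 m Y}}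

    Q≤m : Q ≤ m
    Q≤m = subst (Q ≤_) (sym m≡) (m≤m+n Q r)

    QQY≤W : Q * (Q * Y) ≤ W
    QQY≤W = *-mono-≤ Q≤m (*-monoˡ-≤ Y Q≤m)

    balance : R * W ≡ P * (Q * (Q * Y)) + 12 * ℓ * T
    balance = begin
      12 * ℓ * r * W               ≡⟨ *-assoc (12 * ℓ) r W ⟩
      12 * ℓ * (r * W)             ≡⟨ cong (12 * ℓ *_) excess ⟩
      12 * ℓ * (t₃ + T)            ≡⟨ *-distribˡ-+ (12 * ℓ) t₃ T ⟩
      12 * ℓ * t₃ + 12 * ℓ * T     ≡⟨ cong (_+ 12 * ℓ * T) third ⟩
      P * (Q * (Q * Y)) + 12 * ℓ * T ∎
      where open ≡-Reasoning

    12ℓ≤R : 12 * ℓ ≤ R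
    12ℓ≤R = subst (_≤ R) (*-identityʳ (12 * ℓ)) (*-monoʳ-≤ (12 * ℓ) 1≤r)

    -- From R + 1 ≤ P the balance gives (R+1) Q² ≤ R (Q+r)², that is Q² ≤ R (2Qr + r²) ≤ 3 ℓ² Q r.
    -- But 12ℓ ≤ R < ℓ² forces ℓ > 12, so `large` yields Q ≥ ℓ³, while 12ℓr < ℓ² yields 3r < ℓ.
    -- Hence 3 ℓ² Q r < ℓ³ Q ≤ Q².
    R≮P : ¬ R < P
    R≮P R<P = <⇒≱ quartic (begin
      Q * Q                          ≤⟨ +-cancelˡ-≤ (R * (Q * Q)) _ _ gain ⟩
      R * (2 * Q * r + r * r)        ≤⟨ *-mono-≤ (<⇒≤ (<-trans R<P P<ℓℓ)) (+-monoʳ-≤ (2 * Q * r) (*-monoˡ-≤ r r≤Q)) ⟩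
      ℓ * ℓ * (2 * Q * r + Q * r)    ≡⟨ regroup ℓ Q r ⟩
      ℓ * ℓ * Q * (3 * r)            ∎)
      where
      open ≤-Reasoning
      regroup : ∀ ℓ Q r → ℓ * ℓ * (2 * Q * r + Q * r) ≡ ℓ * ℓ * Q * (3 * r)
      regroup = solve-∀
      regroup₁ : ∀ R Q Y → R * (Q * (Q * Y)) + Q * (Q * Y) ≡ (R * (Q * Q) + Q * Q) * Y
      regroup₁ = solve-∀
      regroup₂ : ∀ R Q r Y → R * ((Q + r) * ((Q + r) * Y)) ≡ (R * (Q * Q) + R * (2 * Q * r + r * r)) * Y
      regroup₂ = solve-∀
      regroup₃ : ∀ ℓ r → 12 * ℓ * r ≡ ℓ * (12 * r)
      regroup₃ = solve-∀
      gain : R * (Q * Q) + Q * Q ≤ R * (Q * Q) + R * (2 * Q * r + r * r)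
      gain = *-cancelʳ-≤ _ _ Y (begin
        (R * (Q * Q) + Q * Q) * Y             ≡⟨ regroup₁ R Q Y ⟨
        R * (Q * (Q * Y)) + Q * (Q * Y)       ≡⟨ +-comm _ (Q * (Q * Y)) ⟩
        suc R * (Q * (Q * Y))                 ≤⟨ *-monoˡ-≤ (Q * (Q * Y)) R<P ⟩
        P * (Q * (Q * Y))                     ≤⟨ m≤m+n _ (12 * ℓ * T) ⟩
        P * (Q * (Q * Y)) + 12 * ℓ * T        ≡⟨ balance ⟨
        R * W                                 ≡⟨ cong (λ x → R * (x * (x * Y))) m≡ ⟩
        R * ((Q + r) * ((Q + r) * Y))         ≡⟨ regroup₂ R Q r Y ⟩
        (R * (Q * Q) + R * (2 * Q * r + r * r)) * Y ∎)
      12≤ℓ : 12 ≤ ℓ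
      12≤ℓ = <⇒≤ (*-cancelʳ-< ℓ 12 ℓ (≤-<-trans 12ℓ≤R (<-trans R<P P<ℓℓ)))
      12r<ℓ : 12 * r < ℓ
      12r<ℓ = *-cancelˡ-< ℓ (12 * r) ℓ (subst (_< ℓ * ℓ) (regroup₃ ℓ r) (<-trans R<P P<ℓℓ))
      3r<ℓ : 3 * r < ℓ
      3r<ℓ = ≤-<-trans (*-monoˡ-≤ r (≤ᵇ⇒≤ 3 12 _)) 12r<ℓ
      ℓℓℓ≤Q : ℓ * (ℓ * ℓ) ≤ Q
      ℓℓℓ≤Q = *-monoʳ-≤ ℓ (large 12≤ℓ)
      instance
        ℓℓQ≢0 : NonZero (ℓ * ℓ * Q)
        ℓℓQ≢0 = m*n≢0 (ℓ * ℓ) Q {{_}} {{>-nonZero (≤-trans z<s ℓℓℓ≤Q)}}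
      r≤Q : r ≤ Q
      r≤Q = ≤-trans (≤-trans (m≤n*m r 3) (<⇒≤ 3r<ℓ)) (≤-trans (m≤m*n ℓ (ℓ * ℓ)) ℓℓℓ≤Q)
      regroup₄ : ∀ ℓ Q → ℓ * ℓ * Q * ℓ ≡ ℓ * (ℓ * ℓ) * Q
      regroup₄ = solve-∀
      quartic : ℓ * ℓ * Q * (3 * r) < Q * Q
      quartic = <-≤-trans (*-monoʳ-< (ℓ * ℓ * Q) 3r<ℓ)
        (≤-trans (≤-reflexive (regroup₄ ℓ Q)) (*-monoˡ-≤ Q ℓℓℓ≤Q))

    -- P = ℓ n + 2, so ℓ would divide 2.
    R≢P : R ≢ P
    R≢P p with ∣⇒≤ (∣m+n∣m⇒∣n (subst (ℓ ∣_) P≡ (subst (ℓ ∣_) p (∣m⇒∣m*n r (n∣m*n 12)))) (m∣m*n n))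
    ... | s≤s (s≤s ())

    module _ (D : ℕ) (R≡ : R ≡ P + D) where

      -- As Q ≤ m, the surplus `D` can only come from the tail: D W ≤ 12 ℓ T. Multiplying by `H`
      -- turns the tail into at most the third term, which is at most P W after scaling by 12 ℓ.
      HD≤P : H * D ≤ P
      HD≤P = *-cancelʳ-≤ (H * D) P W (begin
        H * D * W                ≡⟨ *-assoc H D W ⟩
        H * (D * W)              ≤⟨ *-monoʳ-≤ H DW≤ ⟩
        H * (12 * ℓ * T)         ≡⟨ swap H (12 * ℓ) T ⟩
        12 * ℓ * (H * T)         ≤⟨ *-monoʳ-≤ (12 * ℓ) tail ⟩
        12 * ℓ * t₃              ≡⟨ third ⟩
        P * (Q * (Q * Y))        ≤⟨ *-monoʳ-≤ P QQY≤W ⟩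
        P * W                    ∎)
        where
        open ≤-Reasoning
        swap : ∀ a b c → a * (b * c) ≡ b * (a * c)
        swap = solve-∀
        DW≤ : D * W ≤ 12 * ℓ * T
        DW≤ = +-cancelˡ-≤ (P * W) _ _ (begin
          P * W + D * W                    ≡⟨ *-distribʳ-+ W P D ⟨
          (P + D) * W                      ≡⟨ cong (_* W) R≡ ⟨
          R * W                            ≡⟨ balance ⟩
          P * (Q * (Q * Y)) + 12 * ℓ * T   ≤⟨ +-monoˡ-≤ (12 * ℓ * T) (*-monoʳ-≤ P QQY≤W) ⟩
          P * W + 12 * ℓ * T               ∎)

      D≮1 : ¬ 1 ≤ D
      D≮1 1≤D with 12 ≤? ℓ
      -- Here H itself already exceeds P.
      ... | yes 12≤ℓ = <⇒≱ P<ℓℓ (begin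
        ℓ * ℓ        ≤⟨ large 12≤ℓ ⟩
        k * suc k    ≤⟨ *-monoʳ-≤ k (n≤1+n (suc k)) ⟩
        H            ≡⟨ *-identityʳ H ⟨
        H * 1        ≤⟨ *-monoʳ-≤ H 1≤D ⟩
        H * D        ≤⟨ HD≤P ⟩
        P            ∎)
        where open ≤-Reasoning
      -- Here H ≥ 3 gives 3D ≤ P, so 36ℓ ≤ 3R ≤ 4P = 4ℓn + 8 ≤ 32ℓ + 8 because n = ℓ - 3 ≤ 8; but 8
      -- < 4ℓ.
      ... | no 12≰ℓ = <⇒≱ (+-monoʳ-< (ℓ * 32) (≤-trans (≤ᵇ⇒≤ 9 12 _) (*-monoˡ-≤ 4 (m≤m+n 3 n)))) (begin
        ℓ * 32 + ℓ * 4       ≡⟨ regroup₁ ℓ ⟩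
        3 * (12 * ℓ)         ≤⟨ *-monoʳ-≤ 3 (≤-trans 12ℓ≤R (≤-reflexive R≡)) ⟩
        3 * (P + D)          ≡⟨ *-distribˡ-+ 3 P D ⟩
        3 * P + 3 * D        ≤⟨ +-monoʳ-≤ (3 * P) (*-monoˡ-≤ D (*-mono-≤ 1≤k (+-monoʳ-≤ 2 1≤k))) ⟩
        3 * P + H * D        ≤⟨ +-monoʳ-≤ (3 * P) HD≤P ⟩
        3 * P + P            ≡⟨ cong (λ p → 3 * p + p) P≡ ⟩
        3 * (ℓ * n + 2) + (ℓ * n + 2) ≡⟨ regroup₂ ℓ n ⟩
        ℓ * (4 * n) + 8      ≤⟨ +-monoˡ-≤ 8 (*-monoʳ-≤ ℓ (*-monoʳ-≤ 4 n≤8)) ⟩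
        ℓ * 32 + 8           ∎)
        where
        open ≤-Reasoning
        n≤8 : n ≤ 8
        n≤8 = +-cancelˡ-≤ 3 n 8 (≤-pred (≰⇒> 12≰ℓ))
        regroup₁ : ∀ ℓ → ℓ * 32 + ℓ * 4 ≡ 3 * (12 * ℓ)
        regroup₁ = solve-∀
        regroup₂ : ∀ ℓ n → 3 * (ℓ * n + 2) + (ℓ * n + 2) ≡ ℓ * (4 * n) + 8
        regroup₂ = solve-∀

    contradiction : ⊥
    contradiction with <-cmp R P
    ... | tri< R<P _ _ = R≮P R<P
    ... | tri≈ _ R≡P _ = R≢P R≡P
    ... | tri> _ _ P<R = D≮1 (R ∸ P) (sym (m+[n∸m]≡n (<⇒≤ P<R))) (m<n⇒0<n∸m P<R)

-- The terms of index 0 and 2 vanish and that of index 1 is Q m^(ℓ-1), so (m - Q) m^(ℓ-1) is the sum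
-- of the remaining terms. The 2-adic bound supplies the largeness of k that the size argument
-- requires.
no-centre : ∀ ℓ k m → 3 ≤ ℓ → 1 ≤ k → .{{_ : NonZero m}} → ¬ m ^ ℓ ≡ ∑ (suc ℓ) (term ℓ k m)
no-centre (suc (suc (suc n))) k m 3≤ℓ 1≤k {{m≢0}} eq =
  contradiction (m ∸ Q) m Y t₃ T {{m≢0}} {{m^n≢0 m n {{m≢0}}}}
    (m<n⇒0<n∸m Q<m) (sym (m+[n∸m]≡n (<⇒≤ Q<m))) excess third tail
  where
  open SizeContradiction n k 1≤k (λ 12≤ℓ →
    2^ℓ-bound⇒k-large (3 + n) k 1≤k 12≤ℓ (2^ℓ-bound (3 + n) k m 3≤ℓ 1≤k {{m≢0}} eq))
  t = term ℓ k m
  Y = m ^ n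
  m²Y = m * (m * Y)
  t₃ = t 3
  T = ∑ n (t ∘ (4 +_))

  first : t 1 ≡ Q * m²Y
  first = begin
    2 * ((ℓ C 1) * m²Y * oddPowSum k 1)   ≡⟨ regroup (ℓ C 1) m²Y (oddPowSum k 1) ⟩
    (ℓ C 1) * (2 * oddPowSum k 1) * m²Y   ≡⟨ cong₂ (λ c s → c * s * m²Y) (nC1≡n ℓ) (2*oddPowSum₁ k) ⟩
    Q * m²Y                               ∎
    where
    open ≡-Reasoning
    regroup : ∀ c w s → 2 * (c * w * s) ≡ c * (2 * s) * w
    regroup = solve-∀

  split : m * m²Y ≡ Q * m²Y + (t₃ + T)
  split = begin
    m * m²Y                                   ≡⟨ eq ⟩
    t 0 + (t 1 + (t 2 + (t₃ + T)))          ≡⟨ cong₂ (λ a b → a + (t 1 + (b + (t₃ + T)))) (term-even ℓ k m 0) (term-even ℓ k m 1) ⟩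
    t 1 + (t₃ + T)                          ≡⟨ cong (_+ (t₃ + T)) first ⟩
    Q * m²Y + (t₃ + T)                        ∎
    where open ≡-Reasoning

  -- The factor 12, with the 2 inside the term, makes 24 = 6 · 4 and clears the denominators of C(ℓ,
  -- 3) and S 3. The factor ℓ completes Q².
  third : 12 * ℓ * t₃ ≡ P * (Q * (Q * Y))
  third = begin
    12 * ℓ * (2 * ((ℓ C 3) * Y * oddPowSum k 3))        ≡⟨ regroup ℓ (ℓ C 3) Y (oddPowSum k 3) ⟩
    ℓ * (6 * (ℓ C 3)) * (4 * oddPowSum k 3) * Y         ≡⟨ cong₂ (λ c s → ℓ * c * s * Y) (6*nC3 n) (4*oddPowSum₃ k) ⟩
    ℓ * (ℓ * P) * (k * suc k * (k * suc k)) * Y         ≡⟨ regroup′ ℓ P (k * suc k) Y ⟩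
    P * (Q * (Q * Y))                                   ∎
    where
    open ≡-Reasoning
    regroup : ∀ ℓ c y s → 12 * ℓ * (2 * (c * y * s)) ≡ ℓ * (6 * c) * (4 * s) * y
    regroup = solve-∀
    regroup′ : ∀ ℓ P s y → ℓ * (ℓ * P) * (s * s) * y ≡ P * (ℓ * s * (ℓ * s * y))
    regroup′ = solve-∀

  0<t₃ : 0 < t₃
  0<t₃ = n≢0⇒n>0 (λ t₃≡0 → ≢-nonZero⁻¹ (P * (Q * (Q * Y))) {{PQQY≢0}}
    (trans (sym third) (trans (cong (12 * ℓ *_) t₃≡0) (*-zeroʳ (12 * ℓ)))))
    where
    Q≢0 : NonZero Q
    Q≢0 = m*n≢0 ℓ (k * suc k) {{_}} {{m*n≢0 k (suc k) {{>-nonZero 1≤k}}}}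
    PQQY≢0 : NonZero (P * (Q * (Q * Y)))
    PQQY≢0 = m*n≢0 P (Q * (Q * Y)) {{_}} {{m*n≢0 Q (Q * Y) {{Q≢0}} {{m*n≢0 Q Y {{Q≢0}} {{m^n≢0 m n {{m≢0}}}}}}}}

  Q<m : Q < m
  Q<m = *-cancelʳ-< m²Y Q m (subst (Q * m²Y <_) (sym split) (m<m+n (Q * m²Y) (≤-trans 0<t₃ (m≤m+n t₃ T))))

  excess : (m ∸ Q) * m²Y ≡ t₃ + T
  excess = trans (*-distribʳ-∸ m²Y m Q) (trans (cong (_∸ Q * m²Y) split) (m+n∸m≡n (Q * m²Y) (t₃ + T)))

  -- Decay compares indices 4 to ℓ with indices 2 to ℓ - 2, which lie within 2 to ℓ; as the term of
  -- index 2 is zero, (k+1)² T ≤ t₃ + T.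
  tail : H * T ≤ t₃
  tail = +-cancelʳ-≤ T (H * T) t₃ (begin
    H * T + T                              ≡⟨ regroup k T ⟩
    K * T                                  ≡⟨ ∑-*ˡ n K (t ∘ (4 +_)) ⟨
    ∑ n (λ i → K * t (4 + i))              ≤⟨ ∑-mono n decay ⟩
    ∑ n (t ∘ (2 +_))                       ≤⟨ ∑-drop-2 n (t ∘ (2 +_)) ⟩
    t 2 + (t₃ + T)                         ≡⟨ cong (_+ (t₃ + T)) (term-even ℓ k m 1) ⟩
    t₃ + T                                 ∎)
    where
    open ≤-Reasoning
    K = suc k * suc k
    decay : ∀ i → i < n → K * t (4 + i) ≤ t (2 + i)
    decay i i<n = term-2+-≤ (2 + n) k m (2 + i) (+-monoʳ-≤ 3 i<n) (<⇒≤ Q<m)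
    regroup : ∀ k T → k * (2 + k) * T + T ≡ suc k * suc k * T
    regroup = solve-∀

no-centre 1 k m (s≤s ())
no-centre 2 k m (s≤s (s≤s ()))

theorem1 : (ℓ k n : ℕ) → 3 ≤ ℓ → 1 ≤ k → 1 ≤ n →
    ¬ (powSum n (k + 1) ℓ ≡ powSum (n + k + 1) k ℓ)
theorem1 ℓ k n 3≤ℓ 1≤k 1≤n h =
  no-centre ℓ k (n + k) 3≤ℓ 1≤k {{>-nonZero (≤-trans 1≤n (m≤m+n n k))}} (centre-equation ℓ k n h)
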